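{- Let $n\ge 1$, $\overline{\alpha}\ge 2$ and $m\ge 0$ be integers with $m\overline{\alpha}\le n$. Let $$n-m\overline{\alpha}=q\,(\overline{\alpha}-1)+r$$ be the Euclidean division of $n-m\overline{\alpha}$ by $\overline{\alpha}-1$, with $q,r$ nonnegative integers and $r<\overline{\alpha}-1$. Then the optimal partition of the problem $IPP_0(n,\overline{\alpha},m)$ is $$\mathbf{a}^*_0=(\underbrace{\overline{\alpha},\dots,\overline{\alpha}}_{m},\underbrace{\overline{\alpha}-1,\dots,\overline{\alpha}-1}_{q},r)$$ (completed by zeros, or with the final entry $r$ omitted if it is $0$, to have length $n$), and its optimal objective value is $$\Sigma M_0(n,\overline{\alpha},m)=\frac{m(m+1)}{2}\,\overline{\alpha}+\frac{q(2m+q+1)}{2}\,(\overline{\alpha}-1)+(m+q+1)\,r.$$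
   Context: The problem $IPP_0(n,\overline{\alpha},m)$ is: minimize $f_{\Sigma M}(\mathbf{a})=\sum_{i=1}^n i\,a_i$ over all $\mathbf{a}=(a_i)_{1\le i\le n}\in\mathbb{N}^n$ (with $0\in\mathbb{N}$) such that $\sum_{i=1}^n a_i=n$; $a_i\ge a_{i+1}$ for $i=1,\dots,n-1$; $a_i\le\overline{\alpha}$ for all $i$; and $|\{i: a_i=\overline{\alpha}\}|\le m$. The optimal partition is the minimizer, and $\Sigma M_0(n,\overline{\alpha},m)$ denotes the minimum value. -}

module Defs where

open import Data.Fin.Base using (toℕ)
open import Data.List.Base as List using (List; []; _∷_; _++_)
open import Data.Nat.Base using (ℕ; zero; suc; _+_; _*_; _∸_; _≤_; _≥_)
open import Data.Nat.Properties using (_≟_)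
open import Data.Product.Base using (_×_; ∃-syntax)
open import Data.Vec.Base using (Vec; []; _∷_; lookup; tabulate; sum; count)
open import Data.Vec.Relation.Unary.All using (All)
open import Data.Vec.Relation.Unary.Linked using (Linked)
open import Relation.Binary.PropositionalEquality.Core using (_≡_)

-- Position i : Fin n carries the weight suc (toℕ i), as indices start at 1.
fΣM : ∀ {n} → Vec ℕ n → ℕ
fΣM a = sum (tabulate λ i → suc (toℕ i) * lookup a i)

record Feasible (n α m : ℕ) (a : Vec ℕ n) : Set where
  field
    sum≡n      : sum a ≡ n
    decreasing : Linked _≥_ a
    bounded    : All (_≤ α) a
    few-maxima : count (_≟ α) a ≤ m

IsMinimizer : (n α m : ℕ) → Vec ℕ n → Set
IsMinimizer n α m a =
  Feasible n α m a × (∀ b → Feasible n α m b → fΣM a ≤ fΣM b)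

IsOptimalPartition : (n α m : ℕ) → Vec ℕ n → Set
IsOptimalPartition n α m a =
  IsMinimizer n α m a × (∀ b → IsMinimizer n α m b → b ≡ a)

-- The value ΣM₀(n, α, m) as a relation, since the feasible set may be empty
-- for arbitrary parameters.
IsΣM₀ : (n α m : ℕ) → ℕ → Set
IsΣM₀ n α m v =
  (∃[ a ] (Feasible n α m a × fΣM a ≡ v)) ×
  (∀ b → Feasible n α m b → v ≤ fΣM b)

resize : ∀ n → List ℕ → Vec ℕ n
resize zero    _        = []
resize (suc n) []       = 0 ∷ resize n []
resize (suc n) (x ∷ xs) = x ∷ resize n xs

-- When m * α + q * (α ∸ 1) + r = n with 1 ≤ n, 2 ≤ α and r < α ∸ 1, the list
-- has at most n + 1 entries, and n + 1 only if r = 0; so resize either pads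
-- with zeros or drops a final r that is 0.
a*₀ : (n α m q r : ℕ) → Vec ℕ n
a*₀ n α m q r =
  resize n (List.replicate m α ++ List.replicate q (α ∸ 1) ++ List.[ r ])

{-# OPTIONS --safe #-}
-- Write fΣM as the sum of all suffix sums of the vector. Among feasible
-- partitions the greedy one has the largest entries first, hence pointwise the
-- smallest suffix sums, so it minimises fΣM; a partition attaining the minimum
-- has the same suffix sums and is therefore the greedy one.
module Submission where

open import Defs
open import Data.Fin.Base using (Fin; zero; suc; toℕ)
open import Data.List.Base as List using (List; []; _∷_; _++_)
import Data.List.Relation.Unary.All as List using (All; []; _∷_)
import Data.List.Relation.Unary.All.Properties as List using (++⁺; replicate⁺)
open import Data.List.Relation.Unary.AllPairs using (AllPairs; []; _∷_)
open import Data.Nat.Base using (ℕ; zero; suc; _+_; _*_; _∸_; _≤_; _<_; _≥_; z≤n; s≤s; s≤s⁻¹)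
open import Data.Nat.DivMod using (_/_; m*n/n≡m)
open import Data.Nat.ListAction renaming (sum to sumˡ) using ()
open import Data.Nat.Properties
open import Data.Nat.Tactic.RingSolver using (solve-∀)
open import Data.Product.Base using (_×_; _,_)
open import Data.Vec.Base using (Vec; []; _∷_; lookup; tabulate; sum; count)
import Data.Vec.Relation.Unary.All as Vec
open import Data.Vec.Relation.Unary.All using (All; []; _∷_)
import Data.Vec.Relation.Unary.Linked as Linked
open import Data.Vec.Relation.Unary.Linked using (Linked; []; [-]; _∷_)
open import Data.Vec.Relation.Unary.Linked.Properties using (Linked⇒All)
open import Function.Base using (flip)
open import Relation.Binary.PropositionalEquality.Core using (_≡_; refl; sym; trans; cong; subst)
open import Relation.Nullary using (¬_; yes; no; contradiction)
open import Relation.Unary using (Pred; Decidable)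

private
  variable
    n : ℕ

-- Suffix sums and the objective.

sum-tabulate-+ : (xs : Vec ℕ n) (g : Fin n → ℕ) →
  sum (tabulate λ i → lookup xs i + g i) ≡ sum xs + sum (tabulate g)
sum-tabulate-+ []       g = refl
sum-tabulate-+ (x ∷ xs) g
  rewrite sum-tabulate-+ xs (λ i → g (suc i))
  = shuffle x (g zero) (sum xs) _
  where
  shuffle : ∀ a b c d → a + b + (c + d) ≡ a + c + (b + d)
  shuffle = solve-∀

-- Passing to the tail lowers every weight by one, which removes one copy of each entry; together
-- these copies form the total sum.
fΣM-∷ : ∀ x (xs : Vec ℕ n) → fΣM (x ∷ xs) ≡ sum (x ∷ xs) + fΣM xs
fΣM-∷ x xs
  rewrite sum-tabulate-+ xs (λ i → suc (toℕ i) * lookup xs i) | *-identityˡ x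
  = sym (+-assoc x (sum xs) (fΣM xs))

infix 4 _≼_
-- Suffix sums compared position by position. For decreasing vectors with equal totals, this says
-- that the left one majorizes the right one.
data _≼_ : Vec ℕ n → Vec ℕ n → Set where
  []  : [] ≼ []
  _∷_ : ∀ {x y} {xs ys : Vec ℕ n} →
        sum (x ∷ xs) ≤ sum (y ∷ ys) → xs ≼ ys → x ∷ xs ≼ y ∷ ys

≼⇒fΣM≤ : {a b : Vec ℕ n} → a ≼ b → fΣM a ≤ fΣM b
≼⇒fΣM≤ [] = z≤n
≼⇒fΣM≤ (_∷_ {x = x} {y = y} {xs = xs} {ys = ys} p ps)
  rewrite fΣM-∷ x xs | fΣM-∷ y ys = +-mono-≤ p (≼⇒fΣM≤ ps)

+-≤-tightˡ : ∀ {a b c d} → a ≤ c → b ≤ d → c + d ≤ a + b → c ≤ a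
+-≤-tightˡ {a} {b} {c} {d} a≤c b≤d le =
  +-cancelʳ-≤ d c a (≤-trans le (+-monoʳ-≤ a b≤d))

+-≤-tightʳ : ∀ {a b c d} → a ≤ c → b ≤ d → c + d ≤ a + b → d ≤ b
+-≤-tightʳ {a} {b} {c} {d} a≤c b≤d le =
  +-cancelˡ-≤ c d b (≤-trans le (+-monoˡ-≤ b a≤c))

-- A sum of termwise inequalities is tight only if each of them is, and the suffix sums determine
-- the entries.
≼∧fΣM≥⇒≡ : {a b : Vec ℕ n} → a ≼ b → fΣM b ≤ fΣM a → b ≡ a
≼∧fΣM≥⇒≡ [] _ = refl
≼∧fΣM≥⇒≡ (_∷_ {x = x} {y = y} {xs = xs} {ys = ys} p ps) le
  rewrite fΣM-∷ x xs | fΣM-∷ y ys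
  -- Once the tails agree, the heads differ from the suffix sums by a common summand, which cancels.
  with refl ← ≼∧fΣM≥⇒≡ ps (+-≤-tightʳ p (≼⇒fΣM≤ ps) le)
  = cong (_∷ xs) (+-cancelʳ-≡ (sum xs) y x
      (≤-antisym (+-≤-tightˡ p (≼⇒fΣM≤ ps) le) p))

-- Domination by the greedy partition.

sum-tail-≤ : ∀ {x y s t} → y ≤ x → x + s ≤ y + t → s ≤ t
sum-tail-≤ {x} {y} {s} {t} y≤x le =
  +-cancelˡ-≤ x s t (≤-trans le (+-monoˡ-≤ t y≤x))

sum-resize-[] : ∀ n → sum (resize n []) ≡ 0
sum-resize-[] zero    = refl
sum-resize-[] (suc n) = sum-resize-[] n

resize-[]-≼ : (b : Vec ℕ n) → resize n [] ≼ b
resize-[]-≼         []       = []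
resize-[]-≼ {suc n} (y ∷ ys) =
  subst (_≤ y + sum ys) (sym (sum-resize-[] n)) z≤n ∷ resize-[]-≼ ys

-- Stated for an abstract P?, since does (x ≟ y) reduces to x ≡ᵇ y and so cannot
-- be abstracted by a with.
module _ {a p} {A : Set a} {P : Pred A p} (P? : Decidable P) where

  count-accept : ∀ {x} (xs : Vec A n) → P x →
    count P? (x ∷ xs) ≡ suc (count P? xs)
  count-accept {x = x} _ px with P? x
  ... | yes _  = refl
  ... | no ¬px = contradiction px ¬px

  count-reject : ∀ {x} (xs : Vec A n) → ¬ P x →
    count P? (x ∷ xs) ≡ count P? xs
  count-reject {x = x} _ ¬px with P? x
  ... | yes px = contradiction px ¬px
  ... | no _   = refl

count≡0 : ∀ {β} {b : Vec ℕ n} → All (_≤ β) b → count (_≟ suc β) b ≡ 0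
count≡0 [] = refl
count≡0 {β = β} {_ ∷ ys} (p ∷ ps) =
  trans (count-reject (_≟ suc β) ys (<⇒≢ (s≤s p))) (count≡0 ps)

no-maxima⇒All≤ : ∀ {β} {b : Vec ℕ n} →
  All (_≤ suc β) b → count (_≟ suc β) b ≤ 0 → All (_≤ β) b
no-maxima⇒All≤ [] _ = []
no-maxima⇒All≤ {β = β} {b = y ∷ ys} (p ∷ ps) c with y ≟ suc β
... | yes y≡ = contradiction
  (subst (_≤ 0) (count-accept (_≟ suc β) ys y≡) c) n≮0
... | no  y≢ = s≤s⁻¹ (≤∧≢⇒< p y≢) ∷
  no-maxima⇒All≤ ps (subst (_≤ 0) (count-reject (_≟ suc β) ys y≢) c)

-- A head equal to `suc β` uses up one of the `suc m` allowed maxima. Any other head is at most `β`,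
-- and by monotonicity so is every later entry.
tail-maxima : ∀ {β m y} {ys : Vec ℕ n} → Linked _≥_ (y ∷ ys) → y ≤ suc β →
  count (_≟ suc β) (y ∷ ys) ≤ suc m → count (_≟ suc β) ys ≤ m
tail-maxima {β = β} {m} {y} {ys} dec y≤ c with y ≟ suc β
... | yes y≡ = s≤s⁻¹ (subst (_≤ suc m) (count-accept (_≟ suc β) ys y≡) c)
... | no  y≢ = subst (_≤ m)
  (sym (count≡0 (Vec.tail (Linked⇒All (flip ≤-trans) (s≤s⁻¹ (≤∧≢⇒< y≤ y≢)) dec)))) z≤n

-- An entry `β` on the left is at least its counterpart, so `sum-tail-≤` hands the inequality on to
-- the tails. At `r` the inherited inequality suffices, and after it the left suffix sums are 0.
replicate-≼ : ∀ {β r} q {b : Vec ℕ n} → All (_≤ β) b →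
  let a = resize n (List.replicate q β ++ List.[ r ]) in
  sum a ≤ sum b → a ≼ b
replicate-≼ q                []       le = []
replicate-≼ zero    {y ∷ ys} (p ∷ ps) le = le ∷ resize-[]-≼ ys
replicate-≼ (suc q) {y ∷ ys} (p ∷ ps) le =
  le ∷ replicate-≼ q ps (sum-tail-≤ p le)

-- For `α = suc β`, `a*₀` unfolds to `resize n` of this list.
greedy : (m q β r : ℕ) → List ℕ
greedy m q β r = List.replicate m (suc β) ++ List.replicate q β ++ List.[ r ]

-- While maxima remain, the greedy entry is the bound `suc β` itself. Once `m` reaches 0, what is
-- left of `b` is bounded by `β`, and `replicate-≼` takes over.
greedy-≼ : ∀ {β r} m q {b : Vec ℕ n} →
  Linked _≥_ b → All (_≤ suc β) b → count (_≟ suc β) b ≤ m →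
  sum (resize n (greedy m q β r)) ≤ sum b → resize n (greedy m q β r) ≼ b
greedy-≼ zero    q          dec bnd      c le = replicate-≼ q (no-maxima⇒All≤ bnd c) le
greedy-≼ (suc m) q          dec []       c le = []
greedy-≼ (suc m) q {y ∷ ys} dec (p ∷ ps) c le =
  le ∷ greedy-≼ m q (Linked.tail dec) ps (tail-maxima dec p c) (sum-tail-≤ p le)

-- Feasibility of the greedy partition.

AllPairs-replicate-++ : ∀ {x} k {ys} → AllPairs _≥_ ys → List.All (_≤ x) ys →
  AllPairs _≥_ (List.replicate k x ++ ys)
AllPairs-replicate-++ zero    dec bnd = dec
AllPairs-replicate-++ (suc k) dec bnd =
  List.++⁺ (List.replicate⁺ k ≤-refl) bnd ∷ AllPairs-replicate-++ k dec bnd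

greedy-bounded : ∀ {β r} m q → r < β → List.All (_≤ suc β) (greedy m q β r)
greedy-bounded {β} m q r<β =
  List.++⁺ (List.replicate⁺ m ≤-refl)
    (List.++⁺ (List.replicate⁺ q (n≤1+n β)) (m≤n⇒m≤1+n (<⇒≤ r<β) List.∷ List.[]))

-- With `AllPairs` in place of `Linked`, each entry bounds the whole rest of the list, as
-- `sum-tail-bound` requires.
greedy-decreasing : ∀ {β r} m q → r < β → AllPairs _≥_ (greedy m q β r)
greedy-decreasing {β} m q r<β = AllPairs-replicate-++ m
  (AllPairs-replicate-++ q (List.[] ∷ []) (<⇒≤ r<β List.∷ List.[]))
  -- The instance `m = 0` bounds the part after the maxima.
  (greedy-bounded 0 q r<β)

resize-decreasing : ∀ n {xs} → AllPairs _≥_ xs → Linked _≥_ (resize n xs)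
resize-decreasing zero          _                     = []
resize-decreasing (suc zero)    []                    = [-]
resize-decreasing (suc zero)    (_ ∷ _)               = [-]
resize-decreasing (suc (suc n)) []                    = z≤n ∷ resize-decreasing (suc n) []
resize-decreasing (suc (suc n)) (List.[] ∷ ps)        = z≤n ∷ resize-decreasing (suc n) ps
resize-decreasing (suc (suc n)) ((p List.∷ _) ∷ ps)   = p ∷ resize-decreasing (suc n) ps

resize-All : ∀ n {P : ℕ → Set} {xs} → P 0 → List.All P xs → All P (resize n xs)
resize-All zero    p0 _              = []
resize-All (suc n) p0 List.[]        = p0 ∷ resize-All n p0 List.[]
resize-All (suc n) p0 (p List.∷ ps) = p ∷ resize-All n p0 ps

greedy-count : ∀ n {β r} m q → r < β →
  count (_≟ suc β) (resize n (greedy m q β r)) ≤ m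
greedy-count n       zero    q r<β = ≤-reflexive (count≡0 (resize-All n z≤n
  (List.++⁺ (List.replicate⁺ q ≤-refl) (<⇒≤ r<β List.∷ List.[]))))
greedy-count zero    (suc m) q r<β = z≤n
greedy-count (suc n) {β} {r} (suc m) q r<β = subst (_≤ suc m)
  (sym (count-accept (_≟ suc β) (resize n (greedy m q β r)) refl))
  (s≤s (greedy-count n m q r<β))

-- Truncation and padding of decreasing lists.

All≤0⇒sum≡0 : ∀ {xs} → List.All (_≤ 0) xs → sumˡ xs ≡ 0
All≤0⇒sum≡0 List.[]         = refl
All≤0⇒sum≡0 (z≤n List.∷ ps) = All≤0⇒sum≡0 ps

-- Either x is positive, or all later entries vanish.
sum-tail-bound : ∀ {x xs} → List.All (_≤ x) xs →
  sumˡ (x ∷ xs) ≤ suc n → sumˡ xs ≤ n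
sum-tail-bound {n} {zero}       ps le = subst (_≤ n) (sym (All≤0⇒sum≡0 ps)) z≤n
sum-tail-bound {n} {suc x} {xs} ps le = ≤-trans (m≤n+m (sumˡ xs) x) (s≤s⁻¹ le)

-- A decreasing list with sum at most `n` has at most `n` positive entries, so truncation drops only
-- zeros.
sum-resize : ∀ n {xs} → AllPairs _≥_ xs → sumˡ xs ≤ n →
  sum (resize n xs) ≡ sumˡ xs
sum-resize n       []                 le = sum-resize-[] n
sum-resize zero    (_∷_ {x} {xs} _ _) le = sym (n≤0⇒n≡0 le)
sum-resize (suc n) (_∷_ {x} p ps)     le =
  cong (x +_) (sum-resize n ps (sum-tail-bound p le))

-- The counterpart of `fΣM` on lists, free of the length `n`, so that constant blocks can be
-- evaluated by induction on their size.
suffixSums : List ℕ → ℕ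
suffixSums []       = 0
suffixSums (x ∷ xs) = sumˡ (x ∷ xs) + suffixSums xs

fΣM-resize-[] : ∀ n → fΣM (resize n []) ≡ 0
fΣM-resize-[] zero = refl
fΣM-resize-[] (suc n)
  rewrite fΣM-∷ 0 (resize n []) | sum-resize-[] n = fΣM-resize-[] n

All≤0⇒suffixSums≡0 : ∀ {xs} → List.All (_≤ 0) xs → suffixSums xs ≡ 0
All≤0⇒suffixSums≡0 List.[] = refl
All≤0⇒suffixSums≡0 (z≤n List.∷ ps)
  rewrite All≤0⇒sum≡0 ps = All≤0⇒suffixSums≡0 ps

sum≤0⇒All≤0 : ∀ xs → sumˡ xs ≤ 0 → List.All (_≤ 0) xs
sum≤0⇒All≤0 []       _  = List.[]
sum≤0⇒All≤0 (zero ∷ xs) le = z≤n List.∷ sum≤0⇒All≤0 xs le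

fΣM-resize : ∀ n {xs} → AllPairs _≥_ xs → sumˡ xs ≤ n →
  fΣM (resize n xs) ≡ suffixSums xs
fΣM-resize n       []           le = fΣM-resize-[] n
-- The sum is at most 0 here, so every dropped entry is zero.
fΣM-resize zero    {xs} (_ ∷ _) le = sym (All≤0⇒suffixSums≡0 (sum≤0⇒All≤0 xs le))
fΣM-resize (suc n) (_∷_ {x} {xs} p ps) le
  rewrite fΣM-∷ x (resize n xs) | sum-resize n ps (sum-tail-bound p le)
  = cong (x + sumˡ xs +_) (fΣM-resize n ps (sum-tail-bound p le))

-- Closed form of the optimal value.

triangle : ℕ → ℕ
triangle zero    = 0
triangle (suc k) = suc k + triangle k

triangle*2 : ∀ k → triangle k * 2 ≡ k * (k + 1)
triangle*2 zero = refl
triangle*2 (suc k) =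
  trans (*-distribʳ-+ 2 (suc k) (triangle k))
    (trans (cong (suc k * 2 +_) (triangle*2 k)) (expand k))
  where
  expand : ∀ k → suc k * 2 + k * (k + 1) ≡ suc k * (suc k + 1)
  expand = solve-∀

sum-replicate-++ : ∀ k x ys →
  sumˡ (List.replicate k x ++ ys) ≡ k * x + sumˡ ys
sum-replicate-++ zero    x ys = refl
sum-replicate-++ (suc k) x ys
  rewrite sum-replicate-++ k x ys = sym (+-assoc x (k * x) _)

-- The suffixes starting inside the block contain 1 to `k` copies of `x`, and each of them contains
-- all of `ys`.
suffixSums-replicate-++ : ∀ k x ys →
  suffixSums (List.replicate k x ++ ys) ≡
  triangle k * x + k * sumˡ ys + suffixSums ys
suffixSums-replicate-++ zero    x ys = refl
suffixSums-replicate-++ (suc k) x ys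
  rewrite sum-replicate-++ k x ys | suffixSums-replicate-++ k x ys
  = regroup k x (triangle k) (sumˡ ys) (suffixSums ys)
  where
  regroup : ∀ k x t s w →
    x + (k * x + s) + (t * x + k * s + w) ≡ (suc k + t) * x + suc k * s + w
  regroup = solve-∀

greedy-sum : ∀ m q β r → sumˡ (greedy m q β r) ≡ m * suc β + (q * β + r)
greedy-sum m q β r
  rewrite sum-replicate-++ m (suc β) (List.replicate q β ++ List.[ r ])
        | sum-replicate-++ q β List.[ r ]
        | +-identityʳ r = refl

[m*[m+1]]/2≡triangle : ∀ m → (m * (m + 1)) / 2 ≡ triangle m
[m*[m+1]]/2≡triangle m =
  trans (cong (_/ 2) (sym (triangle*2 m))) (m*n/n≡m (triangle m) 2)

-- The right side is the sum of the positions `m + 1` to `m + q`. The numerator is exactly its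
-- double, so the floor loses nothing.
[q*[2m+q+1]]/2≡q*m+triangle : ∀ m q →
  (q * (2 * m + q + 1)) / 2 ≡ q * m + triangle q
[q*[2m+q+1]]/2≡q*m+triangle m q =
  trans (cong (_/ 2) double) (m*n/n≡m (q * m + triangle q) 2)
  where
  split : ∀ m q → q * (2 * m + q + 1) ≡ q * m * 2 + q * (q + 1)
  split = solve-∀

  double : q * (2 * m + q + 1) ≡ (q * m + triangle q) * 2
  double = trans (split m q)
    (trans (cong (q * m * 2 +_) (sym (triangle*2 q)))
      (sym (*-distribʳ-+ 2 (q * m) (triangle q))))

suffixSums-greedy : ∀ m q β r → suffixSums (greedy m q β r) ≡
  ((m * (m + 1)) / 2) * suc β + ((q * (2 * m + q + 1)) / 2) * β + (m + q + 1) * r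
suffixSums-greedy m q β r
  rewrite suffixSums-replicate-++ m (suc β) (List.replicate q β ++ List.[ r ])
        | suffixSums-replicate-++ q β List.[ r ]
        | sum-replicate-++ q β List.[ r ]
        | [m*[m+1]]/2≡triangle m
        | [q*[2m+q+1]]/2≡q*m+triangle m q
  -- The term `m * (q * β + (r + 0))` shifts the positions of all entries after the maxima by `m`.
  = regroup m q (suc β) β r (triangle m) (triangle q)
  where
  regroup : ∀ m q α β r t u →
    t * α + m * (q * β + (r + 0)) + (u * β + q * (r + 0) + (r + 0 + 0)) ≡
    t * α + (q * m + u) * β + (m + q + 1) * r
  regroup = solve-∀

theorem5 : (n α m q r : ℕ) → 1 ≤ n → 2 ≤ α → m * α ≤ n →
    n ∸ m * α ≡ q * (α ∸ 1) + r → r < α ∸ 1 →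
    IsOptimalPartition n α m (a*₀ n α m q r) ×
    IsΣM₀ n α m
    (((m * (m + 1)) / 2) * α + ((q * (2 * m + q + 1)) / 2) * (α ∸ 1) + (m + q + 1) * r)
theorem5 n (suc β) m q r _ _ mα≤n division r<β =
  ((feasible , minimal) , unique) ,
  ((a*₀ n (suc β) m q r , feasible , value) ,
   λ b fb → ≤-trans (≤-reflexive (sym value)) (minimal b fb))
  where
  total : sumˡ (greedy m q β r) ≡ n
  total = trans (greedy-sum m q β r)
    (trans (cong (m * suc β +_) (sym division)) (m+[n∸m]≡n mα≤n))

  decreasing : AllPairs _≥_ (greedy m q β r)
  decreasing = greedy-decreasing m q r<β

  feasible : Feasible n (suc β) m (a*₀ n (suc β) m q r)
  feasible = record
    { sum≡n      = trans (sum-resize n decreasing (≤-reflexive total)) total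
    ; decreasing = resize-decreasing n decreasing
    ; bounded    = resize-All n z≤n (greedy-bounded m q r<β)
    ; few-maxima = greedy-count n m q r<β
    }

  dominates : ∀ b → Feasible n (suc β) m b → a*₀ n (suc β) m q r ≼ b
  dominates b fb = greedy-≼ m q (Feasible.decreasing fb) (Feasible.bounded fb)
    (Feasible.few-maxima fb)
    -- Both totals are `n`, so the comparison starts from an equality.
    (≤-reflexive (trans (Feasible.sum≡n feasible) (sym (Feasible.sum≡n fb))))

  minimal : ∀ b → Feasible n (suc β) m b → fΣM (a*₀ n (suc β) m q r) ≤ fΣM b
  minimal b fb = ≼⇒fΣM≤ (dominates b fb)

  unique : ∀ b → IsMinimizer n (suc β) m b → b ≡ a*₀ n (suc β) m q r
  unique b (fb , b-min) =
    -- Minimality of `b`, tested against the greedy partition, gives the reverse inequality.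
    ≼∧fΣM≥⇒≡ (dominates b fb) (b-min (a*₀ n (suc β) m q r) feasible)

  value : fΣM (a*₀ n (suc β) m q r) ≡
    ((m * (m + 1)) / 2) * suc β + ((q * (2 * m + q + 1)) / 2) * β + (m + q + 1) * r
  value = trans (fΣM-resize n decreasing (≤-reflexive total)) (suffixSums-greedy m q β r)
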